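{- A linearly ordered set $I$ is spherically complete w.r.t. the order balls if and only if every nonprincipal cut in $I$ is asymmetric.
   Context: A linearly ordered set $I$ is called spherically complete w.r.t. the order balls if every nonempty chain (w.r.t. inclusion) of closed bounded intervals $[a,b]=\{c\in I\mid a\le c\le b\}$ ($a\le b$ in $I$) has nonempty intersection. A cut in $I$ is a pair $(D,E)$ of nonempty subsets of $I$ with $I=D\cup E$ and $d<e$ for all $d\in D$, $e\in E$. The cofinality of the cut is the pair $(\kappa,\lambda)$ where $\kappa=\mathrm{cf}(D)$ is the cofinality of $D$ and $\lambda=\mathrm{ci}(E)$ is the coinitiality of $E$, i.e. the cofinality of $E$ under the reversed ordering (so $\kappa=1$ iff $D$ has a maximal element, $\lambda=1$ iff $E$ has a minimal element). The cut is principal if $D$ has a maximal element or $E$ has a minimal element. The cut is asymmetric if $\kappa\neq\lambda$. -}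

module Defs where

open import Data.Product using (∃; ∃₂; Σ-syntax; _×_; proj₁)
open import Data.Sum using (_⊎_)
open import Function.Bundles using (Injection; Bijection; Surjection)
open import Function.Structures using (IsSplitSurjection)
open import Level using (Level; _⊔_; suc)
open import Relation.Binary.Bundles using (Setoid; TotalOrder)
import Relation.Binary.Construct.Flip.Ord as Flip
import Relation.Binary.Construct.On as On
import Relation.Binary.Properties.TotalOrder as TotalOrderProperties
open import Relation.Nullary using (¬_)
open import Relation.Unary using (Pred; _∈_; _⊆_; _∪_; Satisfiable; Universal)

-- Every surjection of sets splits.  Sets are setoids here, so the section
-- must respect the equalities.
AxiomOfChoice : ∀ a ℓ₁ b ℓ₂ → Set (suc (a ⊔ ℓ₁ ⊔ b ⊔ ℓ₂))
AxiomOfChoice a ℓ₁ b ℓ₂ =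
  (A : Setoid a ℓ₁) (B : Setoid b ℓ₂) (f : Surjection A B) →
  IsSplitSurjection (Setoid._≈_ A) (Setoid._≈_ B) (Surjection.to f)

module _ {c ℓ₁ ℓ₂ : Level} (I : TotalOrder c ℓ₁ ℓ₂) where

  open TotalOrder I using (Carrier; _≤_; module Eq)
  open TotalOrderProperties I using (_<_)

  Subset : Set (suc (c ⊔ ℓ₁ ⊔ ℓ₂))
  Subset = Pred Carrier (c ⊔ ℓ₁ ⊔ ℓ₂)

  record Interval : Set (c ⊔ ℓ₂) where
    field
      lower       : Carrier
      upper       : Carrier
      lower≤upper : lower ≤ upper

  ⟦_⟧ : Interval → Pred Carrier ℓ₂
  ⟦ B ⟧ x = lower ≤ x × x ≤ upper
    where open Interval B

  IntervalSet : Set (suc (c ⊔ ℓ₁ ⊔ ℓ₂))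
  IntervalSet = Pred Interval (c ⊔ ℓ₁ ⊔ ℓ₂)

  IsChain : IntervalSet → Set (c ⊔ ℓ₁ ⊔ ℓ₂)
  IsChain 𝓒 = ∀ {A B} → A ∈ 𝓒 → B ∈ 𝓒 → ⟦ A ⟧ ⊆ ⟦ B ⟧ ⊎ ⟦ B ⟧ ⊆ ⟦ A ⟧

  SphericallyComplete : Set (suc (c ⊔ ℓ₁ ⊔ ℓ₂))
  SphericallyComplete =
    (𝓒 : IntervalSet) → Satisfiable 𝓒 → IsChain 𝓒 →
    ∃ λ x → ∀ {B} → B ∈ 𝓒 → x ∈ ⟦ B ⟧

  record Cut : Set (suc (c ⊔ ℓ₁ ⊔ ℓ₂)) where
    field
      D         : Subset
      E         : Subset
      nonemptyˡ : Satisfiable D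
      nonemptyʳ : Satisfiable E
      covers    : Universal (D ∪ E)
      separated : ∀ {d e} → d ∈ D → e ∈ E → d < e

  HasMaximum : Subset → Set (c ⊔ ℓ₁ ⊔ ℓ₂)
  HasMaximum D = ∃ λ m → m ∈ D × (∀ {x} → x ∈ D → x ≤ m)

  CofinalIn : Subset → Subset → Set (c ⊔ ℓ₁ ⊔ ℓ₂)
  CofinalIn D S = S ⊆ D × (∀ {d} → d ∈ D → ∃ λ s → s ∈ S × d ≤ s)

  -- Equality of elements ignores membership proofs, so bijections between
  -- these setoids compare the cardinalities of the subsets.
  subsetoid : Subset → Setoid (c ⊔ ℓ₁ ⊔ ℓ₂) ℓ₁
  subsetoid S = On.setoid {B = ∃ S} Eq.setoid proj₁

  -- There is no type of cardinals: a cardinal is represented by any set of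
  -- that size, and equality of cardinals is existence of a bijection.
  Cardinal : Set (suc (c ⊔ ℓ₁ ⊔ ℓ₂))
  Cardinal = Setoid (c ⊔ ℓ₁ ⊔ ℓ₂) ℓ₁

  -- κ is the least cardinality of a cofinal subset of D.
  IsCofinality : Subset → Cardinal → Set (suc (c ⊔ ℓ₁ ⊔ ℓ₂))
  IsCofinality D κ =
    (∃ λ S → CofinalIn D S × Bijection κ (subsetoid S)) ×
    (∀ S → CofinalIn D S → Injection κ (subsetoid S))

module _ {c ℓ₁ ℓ₂ : Level} (I : TotalOrder c ℓ₁ ℓ₂) where

  HasMinimum : Subset I → Set (c ⊔ ℓ₁ ⊔ ℓ₂)
  HasMinimum = HasMaximum (Flip.totalOrder I)

  IsCoinitiality : Subset I → Cardinal I → Set (suc (c ⊔ ℓ₁ ⊔ ℓ₂))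
  IsCoinitiality = IsCofinality (Flip.totalOrder I)

  Principal : Cut I → Set (c ⊔ ℓ₁ ⊔ ℓ₂)
  Principal C = HasMaximum I D ⊎ HasMinimum E
    where open Cut C

  Asymmetric : Cut I → Set (suc (c ⊔ ℓ₁ ⊔ ℓ₂))
  Asymmetric C =
    ∀ κ λ′ → IsCofinality I D κ → IsCoinitiality E λ′ → ¬ Bijection κ λ′
    where open Cut C

module Submission where

-- If the cut (D, E) has cofinality (κ, κ), well-order κ so that it does not
-- inject into a proper initial segment.  Enumerations of cofinal subsets of D
-- and E by κ are then bounded on initial segments, hence can be made monotone,
-- and the intervals between them form a chain.  A common point would be a
-- maximum of D or a minimum of E.
--
-- Conversely, a chain of intervals without common point has strictly smaller
-- members inside each member, and the lower and upper ends generate a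
-- nonprincipal cut (D, E).  Well-order D and let W be the longest initial
-- segment whose proper initial segments have no cofinal image in D.  Transfinite
-- recursion along W selects a strictly decreasing sequence of intervals from
-- the chain, so W enumerates cofinal subsets of both sides; the same recursion
-- embeds W into every cofinal subset of D and every coinitial subset of E.
-- Thus |W| is the cofinality of both.

open import Defs
open import Axiom.ExcludedMiddle using (ExcludedMiddle)
open import Data.Empty using (⊥-elim)
open import Data.Product using (∃; _×_; _,_; proj₁; proj₂)
open import Data.Sum using (_⊎_; inj₁; inj₂)
open import Function.Bundles using (_⇔_; Surjection; Injection; Bijection; Func; mk⇔)
import Function.Construct.Composition as Composition
import Function.Construct.Identity as Identity
open import Function.Structures using (IsSplitSurjection)
open import Induction.WellFounded using (WellFounded; Acc; acc; WfRec;
  wf⇒asym; module FixPoint; module All)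
open import Level using (Level; _⊔_; 0ℓ; suc)
open import Relation.Binary.Bundles using (Setoid; TotalOrder)
open import Relation.Binary.Core using (Rel)
open import Relation.Binary.Definitions using (_Respects_; _Respects₂_; Transitive)
import Relation.Binary.Construct.Flip.Ord as Flip
import Relation.Binary.Construct.NonStrictToStrict as ToStrict
import Relation.Binary.Construct.On as On
open import Relation.Binary.PropositionalEquality as ≡ using (_≡_; refl)
import Relation.Binary.Properties.TotalOrder as TotalOrderProperties
open import Relation.Nullary using (¬_; Dec; yes; no; contradiction)
open import Relation.Nullary.Decidable using (True; toWitness; fromWitness)
open import Relation.Unary using (Pred; _∈_; _∉_; _⊆_; ∁; Satisfiable)

-- Well-orders and classical logic.

record WellOrder {a ℓ} (A : Setoid a ℓ) : Set (a ⊔ ℓ ⊔ suc 0ℓ) where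
  open Setoid A using (Carrier; _≈_)
  infix 4 _≺_ _≼_
  field
    -- Valued in the lowest universe, so that initial segments stay at the universe level of `A`.
    _≺_           : Rel Carrier 0ℓ
    ≺-resp-≈      : _≺_ Respects₂ _≈_
    ≺-trans       : Transitive _≺_
    ≺-connex      : ∀ x y → x ≺ y ⊎ x ≈ y ⊎ y ≺ x
    ≺-wellFounded : WellFounded _≺_

  ≺-asym : ∀ {x y} → x ≺ y → ¬ y ≺ x
  ≺-asym = wf⇒asym ≺-wellFounded

  _≼_ : Rel Carrier 0ℓ
  x ≼ y = ¬ y ≺ x

  ≼-refl : ∀ {x} → x ≼ x
  ≼-refl x≺x = ≺-asym x≺x x≺x

  ≺⇒≼ : ∀ {x y} → x ≺ y → x ≼ y
  ≺⇒≼ = ≺-asym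

  ≼-trans : Transitive _≼_
  ≼-trans {x} {y} y⊀x z⊀y z≺x with ≺-connex y x
  ... | inj₁ y≺x        = y⊀x y≺x
  ... | inj₂ (inj₁ y≈x) = z⊀y (proj₁ ≺-resp-≈ (Setoid.sym A y≈x) z≺x)
  ... | inj₂ (inj₂ x≺y) = z⊀y (≺-trans z≺x x≺y)

module Classical (em : ∀ {ℓ} → ExcludedMiddle ℓ) where

  -- Excluded middle makes propositions impredicative: each one is equivalent
  -- to one in the lowest universe.
  ⌈_⌉ : ∀ {p} → Set p → Set
  ⌈ P ⌉ = True (em {P = P})

  ⌈⌉-intro : ∀ {p} {P : Set p} → P → ⌈ P ⌉
  ⌈⌉-intro = fromWitness

  ⌈⌉-elim : ∀ {p} {P : Set p} → ⌈ P ⌉ → P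
  ⌈⌉-elim = toWitness

  byContradiction : ∀ {p} {P : Set p} → ¬ ¬ P → P
  byContradiction {P = P} ¬¬p with em {P = P}
  ... | yes p = p
  ... | no ¬p = contradiction ¬p ¬¬p

  module _ {a ℓ} {A : Setoid a ℓ} (wo : WellOrder A) where
    open Setoid A using (Carrier)
    open WellOrder wo

    abstract
      least : ∀ {p} (P : Pred Carrier p) → Satisfiable P →
              ∃ λ x → x ∈ P × (∀ {y} → y ∈ P → x ≼ y)
      least P (x , px) = search (≺-wellFounded x) px
        where
        search : ∀ {x} → Acc _≺_ x → x ∈ P → ∃ λ x → x ∈ P × (∀ {y} → y ∈ P → x ≼ y)
        search {x} (acc rs) px with em {P = ∃ λ y → y ∈ P × y ≺ x}
        ... | yes (y , py , y≺x) = search (rs y≺x) py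
        ... | no  minimal        = x , px , λ py y≺x → minimal (_ , py , y≺x)

-- Choice functions and Zermelo's well-ordering theorem.

record ChoiceFunction {a ℓ} (A : Setoid a ℓ) (p : Level) : Set (a ⊔ ℓ ⊔ suc p) where
  open Setoid A using (Carrier; _≈_)
  field
    pick      : (P : Pred Carrier p) → Satisfiable P → Carrier
    pick-∈    : ∀ {P} (ne : Satisfiable P) → pick P ne ∈ P
    pick-cong : ∀ {P Q} (neP : Satisfiable P) (neQ : Satisfiable Q) →
                P ⊆ Q → Q ⊆ P → pick P neP ≈ pick Q neQ

-- The surjection `forget` is the identity on carriers, but its codomain compares extensions only. A
-- section that respects this equality must therefore select a point depending on the extension
-- alone, which is `pick-cong`.
choiceFunction : (∀ {a ℓ₁ b ℓ₂} → AxiomOfChoice a ℓ₁ b ℓ₂) →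
                 ∀ {a ℓ} (A : Setoid a ℓ) p → ChoiceFunction A p
choiceFunction ac A p = record
  { pick      = λ P ne → proj₁ (proj₂ (from (P , ne)))
  ; pick-∈    = λ {P} ne → proj₁ (strictlyInverseˡ (P , ne)) (proj₂ (proj₂ (from (P , ne))))
  ; pick-cong = λ {P} {Q} neP neQ P⊆Q Q⊆P →
      proj₂ (from-cong {P , neP} {Q , neQ} (P⊆Q , Q⊆P))
  }
  where
  open Setoid A using (Carrier; _≈_) renaming (refl to ≈-refl; sym to ≈-sym; trans to ≈-trans)

  nonempty : Setoid _ _
  nonempty = record
    { Carrier       = ∃ λ (P : Pred Carrier p) → Satisfiable P
    ; _≈_           = λ (P , _) (Q , _) → P ⊆ Q × Q ⊆ P
    ; isEquivalence = record
      { refl  = (λ x → x) , (λ x → x)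
      ; sym   = λ (f , g) → g , f
      ; trans = λ (f , g) (h , k) → (λ x → h (f x)) , (λ x → g (k x))
      }
    }

  pointed : Setoid _ _
  pointed = record
    { Carrier       = ∃ λ (P : Pred Carrier p) → Satisfiable P
    ; _≈_           = λ (P , x , _) (Q , y , _) → (P ⊆ Q × Q ⊆ P) × x ≈ y
    ; isEquivalence = record
      { refl  = ((λ x → x) , (λ x → x)) , ≈-refl
      ; sym   = λ ((f , g) , e) → (g , f) , ≈-sym e
      ; trans = λ ((f , g) , d) ((h , k) , e) →
          ((λ x → h (f x)) , (λ x → g (k x))) , ≈-trans d e
      }
    }

  forget : Surjection pointed nonempty
  forget = record
    { to         = λ P → P
    ; cong       = proj₁
    ; surjective = λ P → P , proj₁
    }

  open IsSplitSurjection (ac pointed nonempty forget) using (from; from-cong; strictlyInverseˡ)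

-- The towers are the stages of a transfinite enumeration of A by the choice
-- function; x ≺ y means that x is enumerated strictly before y.

module Zermelo (em : ∀ {ℓ} → ExcludedMiddle ℓ)
               {a ℓ} (A : Setoid a ℓ) (choice : ChoiceFunction A 0ℓ) where
  open Setoid A using (Carrier; _≈_) renaming (refl to ≈-refl; sym to ≈-sym; trans to ≈-trans)
  open ChoiceFunction choice
  open Classical em

  infix 10 _⁺
  -- Nothing is added once `P` is everything. The squashing `⌈_⌉` keeps stages in one universe, so
  -- the operation can be iterated.
  _⁺ : Pred Carrier 0ℓ → Pred Carrier 0ℓ
  (P ⁺) x = ⌈ x ∈ P ⊎ (∃ λ (ne : Satisfiable (∁ P)) → x ≈ pick (∁ P) ne) ⌉

  ⋃ : Pred (Pred Carrier 0ℓ) 0ℓ → Pred Carrier 0ℓ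
  ⋃ F x = ⌈ (∃ λ P → P ∈ F × x ∈ P) ⌉

  -- The empty stage arises as the union of the empty family.
  data Tower : Pred (Pred Carrier 0ℓ) (a ⊔ suc 0ℓ) where
    next  : ∀ {P} → Tower P → Tower (P ⁺)
    union : (F : Pred (Pred Carrier 0ℓ) 0ℓ) → (∀ {P} → P ∈ F → Tower P) → Tower (⋃ F)

  ⊆⁺ : ∀ {P} → P ⊆ P ⁺
  ⊆⁺ x∈P = ⌈⌉-intro (inj₁ x∈P)

  ⁺-cong : ∀ {P Q} → P ⊆ Q → Q ⊆ P → P ⁺ ⊆ Q ⁺
  ⁺-cong {P} {Q} P⊆Q Q⊆P x∈P⁺ with ⌈⌉-elim x∈P⁺
  ... | inj₁ x∈P                = ⊆⁺ {Q} (P⊆Q x∈P)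
  ... | inj₂ ((y , y∉P) , x≈c) = ⌈⌉-intro (inj₂ ((y , λ y∈Q → y∉P (Q⊆P y∈Q)) ,
      ≈-trans x≈c (pick-cong _ _ (λ z∉P z∈Q → z∉P (Q⊆P z∈Q)) (λ z∉Q z∈P → z∉Q (P⊆Q z∈P)))))

  resp : ∀ {P} → Tower P → P Respects _≈_
  resp (next t) x≈y x∈ with ⌈⌉-elim x∈
  ... | inj₁ x∈P        = ⌈⌉-intro (inj₁ (resp t x≈y x∈P))
  ... | inj₂ (ne , x≈c) = ⌈⌉-intro (inj₂ (ne , ≈-trans (≈-sym x≈y) x≈c))
  resp (union F ts) x≈y x∈ with ⌈⌉-elim x∈
  ... | P , P∈F , x∈P = ⌈⌉-intro (P , P∈F , resp (ts P∈F) x≈y x∈P)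

  -- Either some member of the family already contains `R`, or every member falls under the first
  -- alternative.
  union-split : ∀ {q r} {F : Pred (Pred Carrier 0ℓ) 0ℓ}
                {Q : Pred Carrier q} {R : Pred Carrier r} →
                (∀ {P} → P ∈ F → P ⊆ Q ⊎ R ⊆ P) →
                ⋃ F ⊆ Q ⊎ R ⊆ ⋃ F
  union-split {F = F} {Q} {R} split with em {P = ∃ λ P → P ∈ F × R ⊆ P}
  ... | yes (P , P∈F , R⊆P) = inj₂ λ x∈R → ⌈⌉-intro (P , P∈F , R⊆P x∈R)
  ... | no  none            = inj₁ λ x∈ → below (⌈⌉-elim x∈)
    where
    below : ∀ {x} → (∃ λ P → P ∈ F × x ∈ P) → x ∈ Q
    below (P , P∈F , x∈P) with split P∈F
    ... | inj₁ P⊆Q = P⊆Q x∈P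
    ... | inj₂ R⊆P = ⊥-elim (none (P , P∈F , R⊆P))

  -- Induction on `Q`. At a successor with `Q ⊆ P`, the hypothesis on `P` leaves two cases: `P` and
  -- `Q` agree, and so do their successors, or `Q ⁺` is still inside `P`.
  next-comparable : ∀ {P} → (∀ {Q} → Tower Q → P ⊆ Q ⊎ Q ⁺ ⊆ P) →
                    ∀ {Q} → Tower Q → Q ⊆ P ⊎ P ⁺ ⊆ Q
  next-comparable ih (union F us) = union-split λ Q∈F → next-comparable ih (us Q∈F)
  next-comparable {P} ih (next {Q} u) with next-comparable ih u | ih u
  ... | inj₂ P⁺⊆Q | _         = inj₂ λ x∈ → ⊆⁺ {Q} (P⁺⊆Q x∈)
  ... | inj₁ Q⊆P  | inj₁ P⊆Q  = inj₂ (⁺-cong {P} {Q} P⊆Q Q⊆P)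
  ... | inj₁ Q⊆P  | inj₂ Q⁺⊆P = inj₁ Q⁺⊆P

  -- Outer induction on `P`; its hypothesis is exactly what `next-comparable` needs for the inner
  -- induction on `Q`.
  comparable : ∀ {P Q} → Tower P → Tower Q → P ⊆ Q ⊎ Q ⁺ ⊆ P
  comparable (union F ts) u = union-split λ P∈F → comparable (ts P∈F) u
  comparable {Q = Q} (next {P} t) u with next-comparable (comparable t) u | comparable t u
  ... | inj₂ P⁺⊆Q | _         = inj₁ P⁺⊆Q
  ... | inj₁ Q⊆P  | inj₁ P⊆Q  = inj₂ (⁺-cong {Q} {P} Q⊆P P⊆Q)
  ... | inj₁ Q⊆P  | inj₂ Q⁺⊆P = inj₂ λ x∈ → ⊆⁺ {P} (Q⁺⊆P x∈)

  Before : Carrier → Pred Carrier 0ℓ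
  Before x = ⋃ (λ P → ⌈ Tower P × x ∉ P ⌉)

  before : ∀ x → Tower (Before x)
  before x = union (λ P → ⌈ Tower P × x ∉ P ⌉) (λ h → proj₁ (⌈⌉-elim h))

  ∉before : ∀ {x} → x ∉ Before x
  ∉before x∈ with ⌈⌉-elim x∈
  ... | P , h , x∈P = proj₂ (⌈⌉-elim h) x∈P

  before-largest : ∀ {P x} → Tower P → x ∉ P → P ⊆ Before x
  before-largest t x∉P y∈P = ⌈⌉-intro (_ , ⌈⌉-intro (t , x∉P) , y∈P)

  -- Otherwise `Before x ⁺` would omit `x` and hence lie in `Before x`, the largest such stage; but
  -- it contains a chosen element outside `Before x`.
  ∈before⁺ : ∀ {x} → x ∈ Before x ⁺
  ∈before⁺ {x} = byContradiction λ x∉ →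
    let c∈ = before-largest (next (before x)) x∉ (⌈⌉-intro (inj₂ ((x , ∉before) , ≈-refl)))
    in pick-∈ {∁ (Before x)} (x , ∉before) c∈

  zermelo : WellOrder A
  zermelo = record
    { _≺_           = λ x y → x ∈ Before y
    ; ≺-resp-≈      = (λ y≈z x∈ → before-largest (before _)
                          (λ z∈ → ∉before (resp (before _) (≈-sym y≈z) z∈)) x∈)
                    , (λ x≈x′ → resp (before _) x≈x′)
    ; ≺-trans       = ≺-trans
    ; ≺-connex      = connex
    ; ≺-wellFounded = λ x → wf (next (before x)) ∈before⁺
    }
    where
    ≺-trans : ∀ {x y z} → x ∈ Before y → y ∈ Before z → x ∈ Before z
    ≺-trans {x} {y} {z} x∈ y∈ with comparable (before y) (before z)
    ... | inj₁ y⊆z  = y⊆z x∈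
    ... | inj₂ z⁺⊆y = contradiction (z⁺⊆y (⊆⁺ {Before z} y∈)) ∉before

    connex : ∀ x y → x ∈ Before y ⊎ x ≈ y ⊎ y ∈ Before x
    connex x y with comparable (before x) (before y) | comparable (before y) (before x)
    ... | inj₂ y⁺⊆x | _         = inj₂ (inj₂ (y⁺⊆x ∈before⁺))
    ... | inj₁ _    | inj₂ x⁺⊆y = inj₁ (x⁺⊆y ∈before⁺)
    ... | inj₁ x⊆y  | inj₁ y⊆x  with ⌈⌉-elim (∈before⁺ {x}) | ⌈⌉-elim (∈before⁺ {y})
    ...   | inj₁ x∈       | _             = contradiction x∈ ∉before
    ...   | inj₂ _        | inj₁ y∈       = contradiction y∈ ∉before
    -- The stages before `x` and `y` agree, and both elements are the one chosen outside that stage.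
    ...   | inj₂ (_ , x≈) | inj₂ (_ , y≈) = inj₂ (inj₁ (≈-trans x≈
            (≈-trans (pick-cong _ _ (λ n m → n (y⊆x m)) (λ n m → n (x⊆y m))) (≈-sym y≈))))

    -- Induction on the stage: whatever precedes an element new in `P ⁺` already belongs to `P`.
    wf : ∀ {P} → Tower P → ∀ {x} → x ∈ P → Acc (λ x y → x ∈ Before y) x
    wf (union F ts) x∈ with ⌈⌉-elim x∈
    ... | P , P∈F , x∈P = wf (ts P∈F) x∈P
    wf (next {P} t) {x} x∈ = acc λ y≺x → earlier y≺x (em {P = x ∈ P})
      where
      earlier : ∀ {y} → y ∈ Before x → Dec (x ∈ P) → Acc (λ x y → x ∈ Before y) y
      earlier y≺x (yes x∈P) with wf t x∈P
      ... | acc rs = rs y≺x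
      earlier y≺x (no  x∉P) with comparable (before x) t
      ... | inj₁ before⊆P  = wf t (before⊆P y≺x)
      ... | inj₂ P⁺⊆before = contradiction (P⁺⊆before x∈) ∉before

-- Strict inequalities, segments and transport of cofinality.

module StrictOrder {c ℓ₁ ℓ₂} (I : TotalOrder c ℓ₁ ℓ₂) where
  open TotalOrder I
  open TotalOrderProperties I public using (_<_; <⇒≱; ≰⇒>; ≰⇒≥; <-trans)

  <-≤-trans : ∀ {x y z} → x < y → y ≤ z → x < z
  <-≤-trans = ToStrict.<-≤-trans _≈_ _≤_ Eq.sym trans antisym ≤-respʳ-≈

  ≤-<-trans : ∀ {x y z} → x ≤ y → y < z → x < z
  ≤-<-trans = ToStrict.≤-<-trans _≈_ _≤_ trans antisym ≤-respˡ-≈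

segment : ∀ {a ℓ} {A : Setoid a ℓ} (wo : WellOrder A) → Setoid.Carrier A → Setoid a ℓ
segment {A = A} wo z = On.setoid {B = ∃ λ y → WellOrder._≺_ wo y z} A proj₁

-- Allows both sides of a symmetric cut to be indexed by one well-ordered set.
IsCofinality-resp : ∀ {c ℓ₁ ℓ₂} (I : TotalOrder c ℓ₁ ℓ₂) {D : Subset I} {κ μ : Cardinal I} →
                    Bijection κ μ → IsCofinality I D μ → IsCofinality I D κ
IsCofinality-resp I β ((S , cofinal , φ) , minimal) =
  (S , cofinal , Composition.bijection β φ) ,
  λ T T-cofinal → Composition.injection (Bijection.injection β) (minimal T T-cofinal)

module _ (em : ∀ {ℓ} → ExcludedMiddle ℓ)
         (ac : ∀ {a ℓ₁ b ℓ₂} → AxiomOfChoice a ℓ₁ b ℓ₂) where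
  open Classical em

  -- Well-orderings by initial ordinals.

  wellOrder : ∀ {a ℓ} (A : Setoid a ℓ) → WellOrder A
  wellOrder A = Zermelo.zermelo em A (choiceFunction ac A 0ℓ)

  IsInitial : ∀ {a ℓ} {A : Setoid a ℓ} → WellOrder A → Set (a ⊔ ℓ)
  IsInitial {A = A} wo = ∀ z → ¬ Injection A (segment wo z)

  -- If `A` embeds in a proper segment, take the least `x` whose segment receives it and pull the
  -- order back along that embedding `ι`. An embedding into a proper segment of the new order would
  -- then put `A` below some `i z ≺ x`.
  initialWellOrder : ∀ {a ℓ} (A : Setoid a ℓ) → ∃ λ (wo : WellOrder A) → IsInitial wo
  initialWellOrder A with em {P = ∃ λ x → Injection A (segment (wellOrder A) x)}
  ... | no  none = wellOrder A , λ z ι → none (z , ι)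
  ... | yes some with least (wellOrder A) (λ x → Injection A (segment (wellOrder A) x)) some
  ...   | x , ι , minimal = pulledBack , λ z j →
            minimal (Composition.injection j (restrict z)) (proj₂ (to z))
    where
    open WellOrder (wellOrder A)
    open Injection ι using (to; cong; injective)

    i : Setoid.Carrier A → Setoid.Carrier A
    i y = proj₁ (to y)

    connex : ∀ y z → i y ≺ i z ⊎ Setoid._≈_ A y z ⊎ i z ≺ i y
    connex y z with ≺-connex (i y) (i z)
    ... | inj₁ y≺z        = inj₁ y≺z
    ... | inj₂ (inj₁ y≈z) = inj₂ (inj₁ (injective y≈z))
    ... | inj₂ (inj₂ z≺y) = inj₂ (inj₂ z≺y)

    pulledBack : WellOrder A
    pulledBack = record
      { _≺_           = λ y z → i y ≺ i z
      ; ≺-resp-≈      = (λ y≈z → proj₁ ≺-resp-≈ (cong y≈z)) , (λ y≈z → proj₂ ≺-resp-≈ (cong y≈z))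
      ; ≺-trans       = ≺-trans
      ; ≺-connex      = connex
      ; ≺-wellFounded = On.wellFounded i ≺-wellFounded
      }

    restrict : ∀ z → Injection (segment pulledBack z) (segment (wellOrder A) (i z))
    restrict z = record
      { to        = λ (y , y≺z) → i y , y≺z
      ; cong      = cong
      ; injective = injective
      }

  -- Spherical completeness implies asymmetry.

  record Ascent {c ℓ₁ ℓ₂} (I : TotalOrder c ℓ₁ ℓ₂) (D : Subset I)
                {κ : Cardinal I} (wo : WellOrder κ) : Set (c ⊔ ℓ₁ ⊔ ℓ₂) where
    open TotalOrder I using (_≤_) renaming (Carrier to ∣I∣)
    open WellOrder wo using (_≼_)
    field
      value         : Setoid.Carrier κ → ∣I∣
      value∈D       : ∀ z → value z ∈ D
      value-mono    : ∀ {y z} → y ≼ z → value y ≤ value z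
      value-cofinal : ∀ {d} → d ∈ D → ∃ λ z → d ≤ value z

  module Increasing {c ℓ₁ ℓ₂} (I : TotalOrder c ℓ₁ ℓ₂) {D : Subset I} {κ : Cardinal I}
                    (cf : IsCofinality I D κ) (wo : WellOrder κ) (initial : IsInitial wo) where
    open TotalOrder I using (_≤_; module Eq; reflexive; trans; total) renaming (Carrier to ∣I∣)
    open StrictOrder I using (≰⇒≥)
    open Setoid κ using () renaming (Carrier to K)
    open WellOrder wo

    private
      S         = proj₁ (proj₁ cf)
      S⊆D       = proj₁ (proj₁ (proj₂ (proj₁ cf)))
      S-cofinal = proj₂ (proj₁ (proj₂ (proj₁ cf)))
      open Bijection (proj₂ (proj₂ (proj₁ cf))) using (to; cong; injective; strictlySurjective)

    s : K → ∣I∣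
    s k = proj₁ (to k)

    s∈D : ∀ k → s k ∈ D
    s∈D k = S⊆D (proj₂ (to k))

    s-cofinal : ∀ {d} → d ∈ D → ∃ λ k → d ≤ s k
    s-cofinal d∈D with S-cofinal d∈D
    ... | x , x∈S , d≤x with strictlySurjective (x , x∈S)
    ...   | k , sk≈x = k , trans d≤x (reflexive (Eq.sym sk≈x))

    private
      Values : K → Subset I
      Values z x = ∃ λ y → y ≺ z × x ≡ s y

      -- Each value returns its recorded index; injectivity of the enumeration makes this respect
      -- equality, and its congruence makes this injective.
      argument : ∀ z → Injection (subsetoid I (Values z)) (segment wo z)
      argument z = record
        { to        = λ (_ , y , y≺z , _) → y , y≺z
        ; cong      = λ { {_ , _ , _ , refl} {_ , _ , _ , refl} x≈x′ → injective x≈x′ }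
        ; injective = λ { {_ , _ , _ , refl} {_ , _ , _ , refl} y≈y′ → cong y≈y′ }
        }

    -- By totality, unbounded values are cofinal in `D`. Minimality of `κ` would then embed `κ` in
    -- them, hence in the segment below `z`.
    bounded : ∀ z → ∃ λ d → d ∈ D × (∀ {y} → y ≺ z → s y ≤ d)
    bounded z = byContradiction λ unbounded → initial z
      (Composition.injection (proj₂ cf (Values z) (values⊆D , exceeded unbounded)) (argument z))
      where
      values⊆D : Values z ⊆ D
      values⊆D (y , _ , refl) = s∈D y

      exceeded : ¬ (∃ λ d → d ∈ D × (∀ {y} → y ≺ z → s y ≤ d)) →
                 ∀ {d} → d ∈ D → ∃ λ x → x ∈ Values z × d ≤ x
      exceeded unbounded {d} d∈D = byContradiction λ none → unbounded
        (d , d∈D , λ {y} y≺z → ≰⇒≥ λ d≤sy → none (s y , (y , y≺z , refl) , d≤sy))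

    Dominates : K → K → Set (c ⊔ ℓ₁ ⊔ ℓ₂)
    Dominates z w = ∀ {y} → y ≼ z → s y ≤ s w

    dominated : ∀ z → ∃ (Dominates z)
    dominated z with bounded z
    ... | d , d∈D , ≺z⇒≤d = above (total d (s z))
      where
      below : ∀ {w} → d ≤ s w → s z ≤ s w → Dominates z w
      below d≤sw sz≤sw {y} y≼z with ≺-connex y z
      ... | inj₁ y≺z        = trans (≺z⇒≤d y≺z) d≤sw
      ... | inj₂ (inj₁ y≈z) = trans (reflexive (cong y≈z)) sz≤sw
      ... | inj₂ (inj₂ z≺y) = contradiction z≺y y≼z

      above : d ≤ s z ⊎ s z ≤ d → ∃ (Dominates z)
      above (inj₁ d≤sz) = z , below d≤sz (reflexive Eq.refl)
      above (inj₂ sz≤d) with s-cofinal d∈D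
      ... | w , d≤sw = w , below d≤sw (trans sz≤d d≤sw)

    -- A substitute for the running supremum of `s`, which may fail to exist: the least index whose
    -- value exceeds all values up to `z`.
    index : K → K
    index z = proj₁ (least wo (Dominates z) (dominated z))

    index-dominates : ∀ z → Dominates z (index z)
    index-dominates z = proj₁ (proj₂ (least wo (Dominates z) (dominated z)))

    index-least : ∀ {z w} → Dominates z w → index z ≼ w
    index-least {z} = proj₂ (proj₂ (least wo (Dominates z) (dominated z)))

    value : K → ∣I∣
    value z = s (index z)

    value∈D : ∀ z → value z ∈ D
    value∈D z = s∈D (index z)

    value-cofinal : ∀ {d} → d ∈ D → ∃ λ z → d ≤ value z
    value-cofinal d∈D with s-cofinal d∈D
    ... | z , d≤sz = z , trans d≤sz (index-dominates z ≼-refl)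

    -- If y ≼ z and the index for y already dominates z, both indices are
    -- least for the same condition; otherwise some value before z exceeds it.
    value-mono : ∀ {y z} → y ≼ z → value y ≤ value z
    value-mono {y} {z} y≼z = by-cases (em {P = Dominates z (index y)})
      where
      by-cases : Dec (Dominates z (index y)) → value y ≤ value z
      by-cases (yes dom) with ≺-connex (index y) (index z)
      ... | inj₁ iy≺iz        = contradiction iy≺iz (index-least dom)
      ... | inj₂ (inj₁ iy≈iz) = reflexive (cong iy≈iz)
      ... | inj₂ (inj₂ iz≺iy) =
        contradiction iz≺iy (index-least λ x≼y → index-dominates z (≼-trans x≼y y≼z))
      by-cases (no ¬dom) = byContradiction λ y≰z → ¬dom λ x≼z →
        ≰⇒≥ λ y≤x → y≰z (trans y≤x (index-dominates z x≼z))

    ascent : Ascent I D wo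
    ascent = record
      { value         = value
      ; value∈D       = value∈D
      ; value-mono    = value-mono
      ; value-cofinal = value-cofinal
      }

  module _ {c ℓ₁ ℓ₂} (I : TotalOrder c ℓ₁ ℓ₂) where
    open TotalOrder I using (trans)

    -- Balls joining values of equal index shrink as the index grows. Their common point is an
    -- extremum of whichever side of the cut contains it.
    ascents⇒principal : SphericallyComplete I → (C : Cut I) → {κ : Cardinal I} (wo : WellOrder κ) →
                        Ascent I (Cut.D C) wo → Ascent (Flip.totalOrder I) (Cut.E C) wo → Principal I C
    ascents⇒principal complete C {κ} wo L U = principal (complete 𝓒 nonempty chain)
      where
      open Cut C
      open WellOrder wo using (_≺_; _≼_; ≺⇒≼)
      module L = Ascent L
      module U = Ascent U

      ball : Setoid.Carrier κ → Interval I
      ball z = record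
        { lower       = L.value z
        ; upper       = U.value z
        ; lower≤upper = proj₁ (separated (L.value∈D z) (U.value∈D z))
        }

      𝓒 : IntervalSet I
      𝓒 B = ∃ λ z → B ≡ ball z

      nonempty : Satisfiable 𝓒
      nonempty = ball z , z , refl
        where z = proj₁ (L.value-cofinal (proj₂ nonemptyˡ))

      nested : ∀ {y z} → y ≼ z → ⟦ I ⟧ (ball z) ⊆ ⟦ I ⟧ (ball y)
      nested y≼z (l≤x , x≤u) = trans (L.value-mono y≼z) l≤x , trans x≤u (U.value-mono y≼z)

      chain : IsChain I 𝓒
      chain (y , refl) (z , refl) with em {P = y ≺ z}
      ... | yes y≺z = inj₂ (nested (≺⇒≼ y≺z))
      ... | no  z≼y = inj₁ (nested z≼y)

      principal : (∃ λ x → ∀ {B} → B ∈ 𝓒 → x ∈ ⟦ I ⟧ B) → Principal I C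
      principal (x , x∈⋂) with covers x
      ... | inj₁ x∈D = inj₁ (x , x∈D , λ d∈D →
              let z , d≤ = L.value-cofinal d∈D in trans d≤ (proj₁ (x∈⋂ (z , refl))))
      ... | inj₂ x∈E = inj₂ (x , x∈E , λ e∈E →
              let z , ≤e = U.value-cofinal e∈E in trans (proj₂ (x∈⋂ (z , refl))) ≤e)

    complete⇒asymmetric : SphericallyComplete I → ∀ C → ¬ Principal I C → Asymmetric I C
    complete⇒asymmetric complete C nonprincipal κ μ cf ci β
      with wo , initial ← initialWellOrder κ = nonprincipal (ascents⇒principal complete C wo
        (Increasing.ascent I cf wo initial)
        (Increasing.ascent (Flip.totalOrder I)
          (IsCofinality-resp (Flip.totalOrder I) β ci) wo initial))

  -- Regular initial segments and greedy transfinite recursion.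

  module Regular {c ℓ₁ ℓ₂} (I : TotalOrder c ℓ₁ ℓ₂) (D : Subset I) (ne : Satisfiable D) where
    open TotalOrder I using (_≤_; module Eq; trans; total; reflexive) renaming (refl to ≤-refl)
    open StrictOrder I using (≰⇒≥)

    D̂ : Cardinal I
    D̂ = subsetoid I D

    abstract
      wo : WellOrder D̂
      wo = wellOrder D̂

    open WellOrder wo
    open Func using (to)

    CofinalOn : ∀ {p} → Func D̂ D̂ → Pred (∃ D) p → Set (c ⊔ ℓ₁ ⊔ ℓ₂ ⊔ p)
    CofinalOn f P = ∀ (d : ∃ D) → ∃ λ y → y ∈ P × proj₁ d ≤ proj₁ (to f y)

    -- The longest initial segment of D̂ all of whose proper initial segments
    -- have only bounded images in D.
    W : Pred (∃ D) 0ℓ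
    W x = ⌈ ¬ (∃ λ f → CofinalOn f (_≺ x)) ⌉

    -- If `W` is everything, the identity works. Otherwise the segment below the least element
    -- outside `W` has a cofinal image, and that segment lies in `W`.
    W-cofinal : ∃ λ f → CofinalOn f W
    W-cofinal with em {P = Satisfiable (∁ W)}
    ... | no  all  = record { to = λ d → d ; cong = λ d≈e → d≈e } ,
          λ d → d , byContradiction (λ d∉W → all (d , d∉W)) , ≤-refl
    ... | yes some = first (least wo (∁ W) some)
      where
      first : (∃ λ x → x ∉ W × (∀ {y} → y ∉ W → x ≼ y)) → ∃ λ f → CofinalOn f W
      first (x , x∉W , minimal) = below-x (byContradiction λ none → x∉W (⌈⌉-intro none))
        where
        below-x : (∃ λ f → CofinalOn f (_≺ x)) → ∃ λ f → CofinalOn f W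
        below-x (f , cofinal) = f , λ d →
          let y , y≺x , d≤fy = cofinal d
          in  y , byContradiction (λ y∉W → minimal y∉W y≺x) , d≤fy

    W-bounded : ∀ {x} → x ∈ W → ∀ f →
                ∃ λ (d : ∃ D) → ∀ {y} → y ≺ x → proj₁ (to f y) ≤ proj₁ d
    W-bounded {x} x∈W f = byContradiction λ unbounded → ⌈⌉-elim x∈W (f , λ d →
      byContradiction λ none → unbounded (d , λ {y} y≺x → ≰⇒≥ λ d≤fy → none (y , y≺x , d≤fy)))

    κ : Cardinal I
    κ = On.setoid {B = ∃ W} D̂ proj₁

    -- Each pick must be `R`-related to all earlier picks; `lo` measures progress in `D`. As long as
    -- the earlier picks stay below some `d`, `extend` supplies a new one. The same recursion serves
    -- for balls of a chain and for members of a given cofinal or coinitial set.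
    module Greedy {x r} (X : Set x) (lo : X → ∃ D) (R : Rel X r)
                  (extend : ∀ (d : ∃ D) → ∃ λ u → proj₁ d ≤ proj₁ (lo u) ×
                            (∀ {v} → proj₁ (lo v) ≤ proj₁ d → R v u)) where

      private
        p : Level
        p = c ⊔ ℓ₁ ⊔ ℓ₂ ⊔ r

        open ChoiceFunction (choiceFunction ac (≡.setoid X) p)

        choose : Pred X p → X
        choose P with em {P = Satisfiable P}
        ... | yes ne = pick P ne
        -- A fixed default for stages without candidates; `greedy-next` shows that stages in `W`
        -- have some.
        ... | no  _  = proj₁ (extend ne)

        choose-∈ : ∀ P → Satisfiable P → choose P ∈ P
        choose-∈ P sat with em {P = Satisfiable P}
        ... | yes ne  = pick-∈ {P} ne
        ... | no  ¬ne = ⊥-elim (¬ne sat)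

        choose-cong : ∀ P Q → P ⊆ Q → Q ⊆ P → choose P ≡ choose Q
        choose-cong P Q P⊆Q Q⊆P with em {P = Satisfiable P} | em {P = Satisfiable Q}
        ... | yes neP       | yes neQ       = pick-cong {P} {Q} neP neQ P⊆Q Q⊆P
        ... | yes (u , u∈P) | no  ¬neQ      = ⊥-elim (¬neQ (u , P⊆Q u∈P))
        ... | no  ¬neP      | yes (u , u∈Q) = ⊥-elim (¬neP (u , Q⊆P u∈Q))
        ... | no  _         | no  _         = refl

        f : Func D̂ D̂
        f = proj₁ W-cofinal

        Next : ∀ x → WfRec _≺_ (λ _ → X) x → Pred X p
        -- Passing `f x` at every `x` of `W` makes the picks cofinal; the second clause makes them
        -- distinct in `greedy-injection`.
        Next x g u = proj₁ (to f x) ≤ proj₁ (lo u) × (∀ {y} (y≺x : y ≺ x) → R (g y≺x) u)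

        step : ∀ x → WfRec _≺_ (λ _ → X) x → X
        step x g = choose (Next x g)

        step-cong : ∀ x {g h : WfRec _≺_ (λ _ → X) x} →
                    (∀ {y} (y≺x : y ≺ x) → g y≺x ≡ h y≺x) → step x g ≡ step x h
        step-cong x {g} {h} g≡h = choose-cong (Next x g) (Next x h)
          (λ (≤u , Ru) → ≤u , λ y≺x → ≡.subst (λ v → R v _) (g≡h y≺x) (Ru y≺x))
          (λ (≤u , Ru) → ≤u , λ y≺x → ≡.subst (λ v → R v _) (≡.sym (g≡h y≺x)) (Ru y≺x))

      greedy : ∃ D → X
      greedy = All.wfRec ≺-wellFounded _ (λ _ → X) step

      private
        unfold : ∀ x → greedy x ≡ step x (λ {y} _ → greedy y)
        unfold x = FixPoint.unfold-wfRec ≺-wellFounded (λ _ → X) step step-cong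

      -- Equal elements have the same predecessors and equal images under `f`, so their candidate
      -- sets have the same extension, and `choose` sees nothing else.
      greedy-cong : ∀ {x y} → proj₁ x Eq.≈ proj₁ y → greedy x ≡ greedy y
      greedy-cong {x} {y} x≈y = ≡.trans (unfold x) (≡.trans
        (choose-cong (Next x _) (Next y _)
          (λ (≤u , Ru) → trans (reflexive (Func.cong f (Eq.sym x≈y))) ≤u ,
                         λ z≺y → Ru (proj₁ ≺-resp-≈ (Eq.sym x≈y) z≺y))
          (λ (≤u , Ru) → trans (reflexive (Func.cong f x≈y)) ≤u ,
                         λ z≺x → Ru (proj₁ ≺-resp-≈ x≈y z≺x)))
        (≡.sym (unfold y)))

      private
        -- The picks define a function on `D̂`, so `W-bounded` bounds those before `x`. Applying
        -- `extend` to the larger of this bound and `f x` yields a candidate.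
        greedy-next : ∀ {x} → x ∈ W → greedy x ∈ Next x (λ {y} _ → greedy y)
        greedy-next {x} x∈W = ≡.subst (_∈ Next x _) (≡.sym (unfold x)) (choose-∈ (Next x _) next)
          where
          values : Func D̂ D̂
          values = record
            { to   = λ y → lo (greedy y)
            ; cong = λ y≈z → Eq.reflexive (≡.cong (λ u → proj₁ (lo u)) (greedy-cong y≈z))
            }

          aboveBoth : (d : ∃ D) → proj₁ (to f x) ≤ proj₁ d →
                      (∀ {y} → y ≺ x → proj₁ (lo (greedy y)) ≤ proj₁ d) →
                      Satisfiable (Next x (λ {y} _ → greedy y))
          aboveBoth d fx≤d values≤d =
            let u , d≤u , Ru = extend d
            in  u , trans fx≤d d≤u , λ y≺x → Ru (values≤d y≺x)

          next : Satisfiable (Next x (λ {y} _ → greedy y))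
          next with W-bounded x∈W values
          ... | d , values≤d with total (proj₁ (to f x)) (proj₁ d)
          ...   | inj₁ fx≤d = aboveBoth d fx≤d values≤d
          ...   | inj₂ d≤fx = aboveBoth (to f x) ≤-refl λ y≺x → trans (values≤d y≺x) d≤fx

      greedy-cofinal : ∀ {d} → d ∈ D → ∃ λ (k : ∃ W) → d ≤ proj₁ (lo (greedy (proj₁ k)))
      greedy-cofinal d∈D with proj₂ W-cofinal (_ , d∈D)
      ... | x , x∈W , d≤fx = (x , x∈W) , trans d≤fx (proj₁ (greedy-next x∈W))

      greedy-injection : ∀ {b ℓ} (B : Setoid b ℓ) (v : X → Setoid.Carrier B) →
                         (∀ {u w} → R u w → ¬ Setoid._≈_ B (v u) (v w)) → Injection κ B
      greedy-injection B v distinct = record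
        { to        = λ (x , _) → v (greedy x)
        ; cong      = λ x≈y → B.reflexive (≡.cong v (greedy-cong x≈y))
        ; injective = λ {j} {k} → injective {j} {k}
        }
        where
        module B = Setoid B

        injective : ∀ {j k : ∃ W} → v (greedy (proj₁ j)) B.≈ v (greedy (proj₁ k)) →
                    proj₁ (proj₁ j) Eq.≈ proj₁ (proj₁ k)
        injective {x , x∈W} {y , y∈W} vx≈vy with ≺-connex x y
        ... | inj₁ x≺y        = ⊥-elim (distinct (proj₂ (greedy-next y∈W) x≺y) vx≈vy)
        ... | inj₂ (inj₁ x≈y) = x≈y
        ... | inj₂ (inj₂ y≺x) = ⊥-elim (distinct (proj₂ (greedy-next x∈W) y≺x) (B.sym vx≈vy))

  -- The symmetric cut of a chain without common point.

  image : ∀ {c ℓ₁ ℓ₂} (I : TotalOrder c ℓ₁ ℓ₂) {κ : Cardinal I} →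
          Injection κ (TotalOrder.Eq.setoid I) → Subset I
  image I ι x = ∃ λ k → x ≡ Injection.to ι k

  image-bijection : ∀ {c ℓ₁ ℓ₂} (I : TotalOrder c ℓ₁ ℓ₂) {κ : Cardinal I}
                    (ι : Injection κ (TotalOrder.Eq.setoid I)) →
                    Bijection κ (subsetoid I (image I {κ} ι))
  image-bijection I ι = record
    { to        = λ k → to k , k , refl
    ; cong      = cong
    ; bijective = injective , λ { (_ , k , refl) → k , cong }
    }
    where open Injection ι

  module CentrelessChain {c ℓ₁ ℓ₂} (I : TotalOrder c ℓ₁ ℓ₂) (𝓒 : IntervalSet I) (ne : Satisfiable 𝓒)
                  (chain : IsChain I 𝓒)
                  (noCentre : ¬ (∃ λ x → ∀ {B} → B ∈ 𝓒 → x ∈ ⟦ I ⟧ B)) where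
    open TotalOrder I using (_≤_; module Eq; trans) renaming (refl to ≤-refl)
    open StrictOrder I
    open Interval

    Iᵒ : TotalOrder c ℓ₁ ℓ₂
    Iᵒ = Flip.totalOrder I

    lower≤upper′ : ∀ {A B} → A ∈ 𝓒 → B ∈ 𝓒 → lower A ≤ upper B
    lower≤upper′ {A} {B} A∈ B∈ with chain A∈ B∈
    ... | inj₁ A⊆B = proj₂ (A⊆B (≤-refl , lower≤upper A))
    ... | inj₂ B⊆A = proj₁ (B⊆A (lower≤upper B , ≤-refl))

    lower<⇒upper≥ : ∀ {A B} → A ∈ 𝓒 → B ∈ 𝓒 → lower A < lower B → upper B ≤ upper A
    lower<⇒upper≥ {A} {B} A∈ B∈ A<B with chain A∈ B∈
    ... | inj₁ A⊆B = ⊥-elim (<⇒≱ A<B (proj₁ (A⊆B (≤-refl , lower≤upper A))))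
    ... | inj₂ B⊆A = proj₂ (B⊆A (lower≤upper B , ≤-refl))

    upper<⇒lower≥ : ∀ {A B} → A ∈ 𝓒 → B ∈ 𝓒 → upper B < upper A → lower A ≤ lower B
    upper<⇒lower≥ {A} {B} A∈ B∈ B<A with chain A∈ B∈
    ... | inj₁ A⊆B = ⊥-elim (<⇒≱ B<A (proj₂ (A⊆B (lower≤upper A , ≤-refl))))
    ... | inj₂ B⊆A = proj₁ (B⊆A (≤-refl , lower≤upper B))

    missed : ∀ x → ∃ λ B → B ∈ 𝓒 × (x < lower B ⊎ upper B < x)
    missed x = byContradiction λ none → noCentre (x , λ {B} B∈ →
      byContradiction (λ B≰x → none (B , B∈ , inj₁ (≰⇒> B≰x))) ,
      byContradiction (λ x≰B → none (B , B∈ , inj₂ (≰⇒> x≰B))))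

    _◁_ : Rel (∃ 𝓒) (ℓ₁ ⊔ ℓ₂)
    (A , _) ◁ (B , _) = lower A < lower B × upper B < upper A

    -- One member of the chain lies beyond the lower end of `A`, another before its upper end; the
    -- smaller of the two does both.
    shrink : ∀ (A : ∃ 𝓒) → ∃ λ B → A ◁ B
    shrink (A , A∈) with missed (lower A) | missed (upper A)
    ... | B , B∈ , inj₂ B<A | _                  = ⊥-elim (<⇒≱ B<A (lower≤upper′ A∈ B∈))
    ... | _                 | B , B∈ , inj₁ A<B  = ⊥-elim (<⇒≱ A<B (lower≤upper′ B∈ A∈))
    ... | B , B∈ , inj₁ A<B | B′ , B′∈ , inj₂ B′<A with chain B∈ B′∈
    ...   | inj₁ B⊆B′ = (B , B∈) , A<B , ≤-<-trans (proj₂ (B⊆B′ (lower≤upper B , ≤-refl))) B′<A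
    ...   | inj₂ B′⊆B = (B′ , B′∈) , <-≤-trans A<B (proj₁ (B′⊆B (≤-refl , lower≤upper B′))) , B′<A

    D E : Subset I
    D x = ∃ λ B → B ∈ 𝓒 × x ≤ lower B
    E x = ∃ λ B → B ∈ 𝓒 × upper B ≤ x

    lower∈D : ((B , _) : ∃ 𝓒) → lower B ∈ D
    lower∈D (B , B∈) = B , B∈ , ≤-refl

    upper∈E : ((B , _) : ∃ 𝓒) → upper B ∈ E
    upper∈E (B , B∈) = B , B∈ , ≤-refl

    cut : Cut I
    cut = record
      { D         = D
      ; E         = E
      ; nonemptyˡ = _ , lower∈D ne
      ; nonemptyʳ = _ , upper∈E ne
      ; covers    = covers
      ; separated = separated
      }
      where
      covers : ∀ x → x ∈ D ⊎ x ∈ E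
      covers x with missed x
      ... | B , B∈ , inj₁ x<B = inj₁ (B , B∈ , proj₁ x<B)
      ... | B , B∈ , inj₂ B<x = inj₂ (B , B∈ , proj₁ B<x)

      separated : ∀ {d e} → d ∈ D → e ∈ E → d < e
      separated (A , A∈ , d≤A) (B , B∈ , B≤e) =
        -- Lower ends are only weakly below upper ends; shrinking `A` first gives strictness.
        let (A′ , A′∈) , A<A′ , _ = shrink (A , A∈)
        in  <-≤-trans (≤-<-trans d≤A A<A′) (trans (lower≤upper′ A′∈ B∈) B≤e)

    nonprincipal : ¬ Principal I cut
    nonprincipal (inj₁ (m , (A , A∈ , m≤A) , D≤m)) =
      let B , A<B , _ = shrink (A , A∈) in <⇒≱ (≤-<-trans m≤A A<B) (D≤m (lower∈D B))
    nonprincipal (inj₂ (m , (A , A∈ , A≤m) , m≤E)) =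
      let B , _ , B<A = shrink (A , A∈) in <⇒≱ (<-≤-trans B<A A≤m) (m≤E (upper∈E B))

    open Regular I D (_ , lower∈D ne) using (κ; module Greedy)

    lo : ∃ 𝓒 → ∃ D
    lo B = lower (proj₁ B) , lower∈D B

    -- A single shrinking would make only the lower ends increase strictly.
    extendBalls : ∀ (d : ∃ D) → ∃ λ B → proj₁ d ≤ lower (proj₁ B) ×
             (∀ {A} → lower (proj₁ A) ≤ proj₁ d → A ◁ B)
    extendBalls (d , A , A∈ , d≤A) =
      let (B , B∈) , A<B , _   = shrink (A , A∈)
          (C , C∈) , B<C , C<B = shrink (B , B∈)
          d<B                  = ≤-<-trans d≤A A<B
      in  (C , C∈) , proj₁ (<-trans d<B B<C) , λ {(A′ , A′∈)} A′≤d →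
            let A′<B = ≤-<-trans A′≤d d<B
            in  <-trans A′<B B<C , <-≤-trans C<B (lower<⇒upper≥ A′∈ B∈ A′<B)

    -- One recursion serves both sides: the same picks give lower ends in `D` and upper ends in `E`,
    -- indexed by the same `κ`.
    module Balls = Greedy (∃ 𝓒) lo _◁_ extendBalls

    lowers : Injection κ Eq.setoid
    lowers = Balls.greedy-injection Eq.setoid (λ B → lower (proj₁ B)) (λ A◁B → proj₂ (proj₁ A◁B))

    uppers : Injection κ (TotalOrder.Eq.setoid Iᵒ)
    uppers = Balls.greedy-injection (TotalOrder.Eq.setoid Iᵒ) (λ B → upper (proj₁ B))
               (λ A◁B → proj₂ (proj₂ A◁B))

    cofinality : IsCofinality I D κ
    cofinality =
      (image I {κ} lowers , (lowers⊆D , lowers-cofinal) , image-bijection I lowers) , minimal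
      where
      lowers⊆D : image I {κ} lowers ⊆ D
      lowers⊆D ((x , _) , refl) = lower∈D (Balls.greedy x)

      lowers-cofinal : ∀ {d} → d ∈ D → ∃ λ x → x ∈ image I {κ} lowers × d ≤ x
      lowers-cofinal d∈D =
        let k , d≤k = Balls.greedy-cofinal d∈D in _ , (k , refl) , d≤k

      -- The recursion is rerun inside `T`: shrinking a ball that bounds `d` gives a lower end
      -- strictly above `d`, and `T` reaches beyond it.
      minimal : ∀ T → CofinalIn I D T → Injection κ (subsetoid I T)
      minimal T (T⊆D , T-cofinal) = greedy-injection (subsetoid I T) (λ t → t) proj₂
        where
        extend : ∀ (d : ∃ D) → ∃ λ (u : ∃ T) → proj₁ d ≤ proj₁ u ×
                 (∀ {v : ∃ T} → proj₁ v ≤ proj₁ d → proj₁ v < proj₁ u)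
        extend (d , A , A∈ , d≤A) =
          let B , A<B , _   = shrink (A , A∈)
              t , t∈T , B≤t = T-cofinal (lower∈D B)
              d<t           = ≤-<-trans d≤A (<-≤-trans A<B B≤t)
          in  (t , t∈T) , proj₁ d<t , λ v≤d → ≤-<-trans v≤d d<t

        open Greedy (∃ T) (λ (t , t∈T) → t , T⊆D t∈T) (λ v u → proj₁ v < proj₁ u) extend

    coinitiality : IsCoinitiality I E κ
    coinitiality =
      (image Iᵒ {κ} uppers , (uppers⊆E , uppers-coinitial) , image-bijection Iᵒ uppers) , minimal
      where
      uppers⊆E : image Iᵒ {κ} uppers ⊆ E
      uppers⊆E ((x , _) , refl) = upper∈E (Balls.greedy x)

      -- Coinitiality is inherited from the lower ends: a pick whose lower end passes strictly
      -- beyond that of `A` has an upper end at most that of `A`.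
      uppers-coinitial : ∀ {e} → e ∈ E → ∃ λ x → x ∈ image Iᵒ {κ} uppers × x ≤ e
      uppers-coinitial (A , A∈ , A≤e) =
        let B , A<B , _ = shrink (A , A∈)
            k , B≤k     = Balls.greedy-cofinal (lower∈D B)
            C , C∈      = Balls.greedy (proj₁ k)
        in  upper C , (k , refl) , trans (lower<⇒upper≥ A∈ C∈ (<-≤-trans A<B B≤k)) A≤e

      -- Progress is measured in `D`, so each `t` in `T` is represented by the lower end of a ball
      -- whose upper end is at most `t`.
      minimal : ∀ T → CofinalIn Iᵒ E T → Injection κ (subsetoid Iᵒ T)
      minimal T (T⊆E , T-coinitial) = greedy-injection (subsetoid Iᵒ T) (λ t → t) proj₂
        where
        ball : ∃ T → Interval I
        ball (_ , t∈T) = proj₁ (T⊆E t∈T)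

        ball∈𝓒 : ∀ t → ball t ∈ 𝓒
        ball∈𝓒 (_ , t∈T) = proj₁ (proj₂ (T⊆E t∈T))

        ball≤ : ∀ t → upper (ball t) ≤ proj₁ t
        ball≤ (_ , t∈T) = proj₂ (proj₂ (T⊆E t∈T))

        extend : ∀ (d : ∃ D) → ∃ λ (u : ∃ T) → proj₁ d ≤ lower (ball u) ×
                 (∀ {v : ∃ T} → lower (ball v) ≤ proj₁ d → proj₁ u < proj₁ v)
        extend (d , A , A∈ , d≤A) =
          let (B , B∈) , A<B , _   = shrink (A , A∈)
              -- The upper end of `B` separates: earlier `v` lie at or above it because `B` starts
              -- beyond `d`, while `C` forces `u` strictly below it.
              (C , C∈) , _   , C<B = shrink (B , B∈)
              t , t∈T , t≤C        = T-coinitial (upper∈E (C , C∈))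
              u                    = t , t∈T
              u<B                  = ≤-<-trans t≤C C<B
              d<B                  = ≤-<-trans d≤A A<B
          in  u , trans (proj₁ d<B) (upper<⇒lower≥ B∈ (ball∈𝓒 u) (≤-<-trans (ball≤ u) u<B)) ,
              λ {v} v≤d → <-≤-trans u<B
                (trans (lower<⇒upper≥ (ball∈𝓒 v) B∈ (≤-<-trans v≤d d<B)) (ball≤ v))

        open Greedy (∃ T) (λ t → lower (ball t) , lower∈D (ball t , ball∈𝓒 t))
          (λ v u → proj₁ u < proj₁ v) extend

    symmetric : ¬ Asymmetric I cut
    symmetric asymmetric = asymmetric κ κ cofinality coinitiality (Identity.bijection κ)

  asymmetric⇒complete : ∀ {c ℓ₁ ℓ₂} (I : TotalOrder c ℓ₁ ℓ₂) →
                        (∀ C → ¬ Principal I C → Asymmetric I C) → SphericallyComplete I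
  asymmetric⇒complete I asymmetric 𝓒 ne chain = byContradiction λ noCentre →
    symmetric I 𝓒 ne chain noCentre
      (asymmetric (cut I 𝓒 ne chain noCentre) (nonprincipal I 𝓒 ne chain noCentre))
    where open CentrelessChain

proposition1 : (∀ {ℓ} → ExcludedMiddle ℓ) →
    (∀ {a ℓ₁ b ℓ₂} → AxiomOfChoice a ℓ₁ b ℓ₂) →
    ∀ {c ℓ₁ ℓ₂} (I : TotalOrder c ℓ₁ ℓ₂) →
    SphericallyComplete I ⇔ (∀ (C : Cut I) → ¬ Principal I C → Asymmetric I C)
proposition1 em ac I = mk⇔ (complete⇒asymmetric em ac I) (asymmetric⇒complete em ac I)
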